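{- Let $X$ be a non-empty set and let $\Phi=\{(\varphi_i,U_i)\}_{i\in I}$ be an $n$-dimensional topological atlas on $X$ with index set $I\subseteq\Sigma^*$. Then the triple $\mathbf Z_\Phi=(X,\mathcal B_\Phi,\lambda_\Phi)$ is a computable predicate space.
   Context: $\Sigma$ is a finite alphabet containing $0,1$; $\Sigma^*$ is the set of finite words over $\Sigma$. Put $\iota(a_1\cdots a_k)=110a_10a_20\cdots 0a_k011$ and $\langle u,v\rangle=\iota(u)\iota(v)$. A notation of a set $S$ is a surjective partial map $\subseteq\Sigma^*\to S$. **Predicate spaces.** An effective predicate space is a triple $(X,\sigma,\lambda)$ where $\sigma\subseteq 2^X$ is countable with $\bigcup\sigma=X$, $\lambda:\subseteq\Sigma^*\to\sigma$ is a notation of $\sigma$, and for all $x,y\in X$: $x=y$ if and only if $\mathcal P_x(X)=\mathcal P_y(X)$, where $\mathcal P_x(X)=\{U\in\sigma: x\in U\}$. It is a computable predicate space if moreover $\operatorname{dom}\lambda$ is a computable (decidable) subset of $\Sigma^*$. **Atlases.** An $n$-dimensional topological atlas on $X$ is a family $\{(\varphi_i,U_i)\}_{i\in I}$ where the $U_i\subseteq X$ cover $X$, each $\varphi_i$ is a bijection of $U_i$ onto an open subset of $\mathbb R^n$, each $\varphi_i[U_i\cap U_j]$ is open in $\mathbb R^n$, and the maps $\varphi_j\varphi_i^{ -1}:\varphi_i[U_i\cap U_j]\to\varphi_j[U_i\cap U_j]$ are homeomorphisms. **Computable balls.** $\mu^n$ is a canonical notation, with computable domain, of the set of all open balls of $\mathbb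 R^n$ with rational centers and rational radii. For $i\in\Sigma^*$, $w\in\operatorname{dom}\mu^n$ put $B_{\langle i,w\rangle}=\varphi_i^{ -1}[\mu^n(w)]$ if $i\in I$ and $\mu^n(w)\subseteq\varphi_i[U_i]$, and $B_{\langle i,w\rangle}=\varnothing$ otherwise. $\mathcal B_\Phi$ is the set of all these $B_{\langle i,w\rangle}$, and the notation $\lambda_\Phi:\subseteq\Sigma^*\to\mathcal B_\Phi$ has domain $\{\langle i,w\rangle: i\in\Sigma^*,w\in\operatorname{dom}\mu^n\}$ and $\lambda_\Phi(\langle i,w\rangle)=B_{\langle i,w\rangle}$. -}

module Defs where

open import Level using (Level; 0ℓ; _⊔_) renaming (suc to lsuc)
open import Data.Nat as ℕ using (ℕ; zero; suc)
import Data.Nat.Properties as ℕₚ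
open import Data.Fin using (Fin; zero; suc)
open import Data.List as List using (List; []; _∷_; _++_)
import Data.List.Properties as Listₚ
open import Data.Maybe using (Maybe; just)
open import Data.Product using (Σ; Σ-syntax; ∃; ∃₂; _×_; _,_; proj₁; proj₂)
open import Data.Rational as ℚ using (ℚ; 0ℚ; 1ℚ; ½; ∣_∣)
import Data.Rational.Properties as ℚₚ
open import Data.Rational.Solver using (module +-*-Solver)
open import Data.Sum using (_⊎_; inj₁; inj₂)
open import Data.Vec as Vec using (Vec)
open import Data.Vec.Relation.Binary.Pointwise.Inductive using (Pointwise)
open import Data.Vec.Functional as Vector using (Vector)
import Data.Vec.Functional.Relation.Binary.Equality.Setoid as VectorEq
open import Function using (Func; Injection; Inverseᵇ; _⇔_)
open import Relation.Binary using (Setoid; _Respects_)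
open import Relation.Binary.PropositionalEquality
  using (_≡_; refl; sym; trans; cong; subst)
open import Relation.Nullary using (¬_)
open import Relation.Unary using (Pred; Irrelevant)
import Relation.Unary as U

private variable
  a ℓ ℓ₁ ℓ₂ : Level

------------------------------------------------------------------------
-- Sets and subsets
--
-- Sets are setoids, so that ℝ can be a set without quotient types.

record Subset (S : Setoid a ℓ) (p : Level) : Set (a ⊔ ℓ ⊔ lsuc p) where
  open Setoid S
  field
    pred : Pred Carrier p
    resp : pred Respects _≈_

open Subset public

infix 4 _∈_ _⊆_ _≐_

_∈_ : {S : Setoid a ℓ} → Setoid.Carrier S → Subset S ℓ₁ → Set ℓ₁
x ∈ A = pred A x

_⊆_ : {S : Setoid a ℓ} → Subset S ℓ₁ → Subset S ℓ₂ → Set (a ⊔ ℓ₁ ⊔ ℓ₂)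
A ⊆ B = pred A U.⊆ pred B

_≐_ : {S : Setoid a ℓ} → Subset S ℓ₁ → Subset S ℓ₂ → Set (a ⊔ ℓ₁ ⊔ ℓ₂)
A ≐ B = pred A U.≐ pred B

_∩_ : {S : Setoid a ℓ} → Subset S ℓ₁ → Subset S ℓ₂ → Subset S (ℓ₁ ⊔ ℓ₂)
A ∩ B = record
  { pred = pred A U.∩ pred B
  ; resp = λ e (x∈A , x∈B) → resp A e x∈A , resp B e x∈B
  }

⟦_⟧ : {S : Setoid a ℓ} → Subset S ℓ₁ → Setoid (a ⊔ ℓ₁) ℓ
⟦_⟧ {S = S} A = record
  { Carrier = Σ S.Carrier (pred A)
  ; _≈_ = λ x y → proj₁ x S.≈ proj₁ y
  ; isEquivalence = record { refl = S.refl ; sym = S.sym ; trans = S.trans }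
  }
  where module S = Setoid S

Power : Setoid a ℓ → (p : Level) → Setoid (a ⊔ ℓ ⊔ lsuc p) (a ⊔ p)
Power S p = record
  { Carrier = Subset S p
  ; _≈_ = _≐_
  ; isEquivalence = record
    { refl = (λ x → x) , (λ x → x)
    ; sym = λ (f , g) → g , f
    ; trans = λ (f , g) (f′ , g′) → (λ x → f′ (f x)) , (λ x → g (g′ x))
    }
  }

-- Possibly finite, possibly empty: `Maybe` lets the enumeration skip numbers.
Countable : Setoid a ℓ → Set (a ⊔ ℓ)
Countable S = Σ[ f ∈ (ℕ → Maybe Carrier) ]
    (∀ s → ∃₂ λ n t → f n ≡ just t × t ≈ s)
  where open Setoid S

------------------------------------------------------------------------
-- Words

-- An alphabet of 2 + k letters; its first two letters are the 0 and 1 of Σ.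
Letter : ℕ → Set
Letter k = Fin (2 ℕ.+ k)

Word : ℕ → Set
Word k = List (Letter k)

module _ {k : ℕ} where

  𝟎 𝟏 : Letter k
  𝟎 = zero
  𝟏 = suc zero

  ι : Word k → Word k
  ι w = 𝟏 ∷ 𝟏 ∷ List.concatMap (λ x → 𝟎 ∷ x ∷ []) w ++ 𝟎 ∷ 𝟏 ∷ 𝟏 ∷ []

  ⟨_,_⟩ : Word k → Word k → Word k
  ⟨ u , v ⟩ = ι u ++ ι v

  ι-prefix-free : ∀ u v {s t} → ι u ++ s ≡ ι v ++ t → u ≡ v × s ≡ t
  ι-prefix-free u v e = body u v (Listₚ.∷-injectiveʳ (Listₚ.∷-injectiveʳ e))
    where
    code : Word k → Word k
    code w = List.concatMap (λ x → 𝟎 ∷ x ∷ []) w ++ 𝟎 ∷ 𝟏 ∷ 𝟏 ∷ []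
    body : ∀ u v {s t} → code u ++ s ≡ code v ++ t → u ≡ v × s ≡ t
    body [] [] refl = refl , refl
    body [] (_ ∷ []) ()
    body [] (_ ∷ _ ∷ _) ()
    body (_ ∷ []) [] ()
    body (_ ∷ _ ∷ _) [] ()
    body (x ∷ u) (y ∷ v) e
      with refl ← Listₚ.∷-injectiveˡ (Listₚ.∷-injectiveʳ e)
      with refl , e′ ← body u v (Listₚ.∷-injectiveʳ (Listₚ.∷-injectiveʳ e))
      = refl , e′

  ⟨,⟩-injective : ∀ {u v u′ v′} → ⟨ u , v ⟩ ≡ ⟨ u′ , v′ ⟩ → u ≡ u′ × v ≡ v′
  ⟨,⟩-injective {u} {v} {u′} {v′} e with ι-prefix-free u u′ e
  ... | refl , e′ =
    refl , proj₁ (ι-prefix-free v v′ {[]} {[]} (cong (_++ []) e′))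

------------------------------------------------------------------------
-- Computability on words
--
-- The partial recursive word functions over the alphabet: the least class
-- containing the empty word, the left successors and the projections and
-- closed under composition, primitive recursion on words and minimisation
-- over the words 0ʲ.  These are exactly the Turing computable word functions.

data Rec (k : ℕ) : ℕ → Set where
  ε      : ∀ {n} → Rec k n
  cons   : Letter k → Rec k 1
  proj   : ∀ {n} → Fin n → Rec k n
  comp   : ∀ {m n} → Rec k m → Vec (Rec k n) m → Rec k n
  prec   : ∀ {n} → Rec k n → (Letter k → Rec k (2 ℕ.+ n)) → Rec k (1 ℕ.+ n)
  search : ∀ {n} → Rec k (1 ℕ.+ n) → Rec k n

infix 4 _[_]⇓_

data _[_]⇓_ {k} : ∀ {n} → Rec k n → Vec (Word k) n → Word k → Set where
  ε⇓ : ∀ {n} {xs : Vec (Word k) n} → ε [ xs ]⇓ []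

  cons⇓ : ∀ {l w} → cons l [ w Vec.∷ Vec.[] ]⇓ l ∷ w

  proj⇓ : ∀ {n} {i : Fin n} {xs} → proj i [ xs ]⇓ Vec.lookup xs i

  comp⇓ : ∀ {m n} {f : Rec k m} {gs : Vec (Rec k n) m} {xs ys z} →
          Pointwise (λ g y → g [ xs ]⇓ y) gs ys → f [ ys ]⇓ z →
          comp f gs [ xs ]⇓ z

  prec-[]⇓ : ∀ {n} {g : Rec k n} {h xs z} → g [ xs ]⇓ z →
             prec g h [ [] Vec.∷ xs ]⇓ z

  prec-∷⇓ : ∀ {n} {g : Rec k n} {h xs l w y z} →
            prec g h [ w Vec.∷ xs ]⇓ y → h l [ w Vec.∷ y Vec.∷ xs ]⇓ z →
            prec g h [ (l ∷ w) Vec.∷ xs ]⇓ z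

  search⇓ : ∀ {n} {f : Rec k (1 ℕ.+ n)} {xs} j →
            (∀ {i} → i ℕ.< j →
               ∃₂ λ l w → f [ List.replicate i 𝟎 Vec.∷ xs ]⇓ l ∷ w) →
            f [ List.replicate j 𝟎 Vec.∷ xs ]⇓ [] →
            search f [ xs ]⇓ List.replicate j 𝟎

-- The characteristic function of D, with values the words 1 and 0, is recursive.
Computable : ∀ {k} → Pred (Word k) ℓ → Set ℓ
Computable {k = k} D = Σ[ χ ∈ Rec k 1 ]
  (∀ w → (D w × χ [ w Vec.∷ Vec.[] ]⇓ 𝟏 ∷ [])
       ⊎ (¬ D w × χ [ w Vec.∷ Vec.[] ]⇓ 𝟎 ∷ []))

------------------------------------------------------------------------
-- Notations and predicate spaces

record PartialMap (k : ℕ) (S : Setoid a ℓ) : Set (lsuc 0ℓ ⊔ a ⊔ ℓ) where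
  open Setoid S
  field
    dom     : Pred (Word k) 0ℓ
    app     : ∀ w → dom w → Carrier
    app-irr : ∀ {w} (p q : dom w) → app w p ≈ app w q

open PartialMap public

IsNotation : ∀ {k} {S : Setoid a ℓ} → PartialMap k S → Set (a ⊔ ℓ)
IsNotation {S = S} f = ∀ s → ∃₂ λ w p → app f w p ≈ s
  where open Setoid S

-- 𝓟 X σ x is the set 𝓟ₓ(X) of the members of σ that contain x.
𝓟 : (X : Setoid a ℓ) → Subset (Power X ℓ₁) ℓ₂ → Setoid.Carrier X →
    Subset (Power X ℓ₁) (ℓ₁ ⊔ ℓ₂)
𝓟 X σ x = record
  { pred = λ V → V ∈ σ × x ∈ V
  ; resp = λ V≐W (V∈σ , x∈V) → resp σ V≐W V∈σ , proj₁ V≐W x∈V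
  }

record IsEffectivePredicateSpace {k : ℕ} (X : Setoid a ℓ)
         (σ : Subset (Power X ℓ₁) ℓ₂) (ν : PartialMap k ⟦ σ ⟧)
       : Set (a ⊔ ℓ ⊔ lsuc ℓ₁ ⊔ ℓ₂) where
  open Setoid X
  field
    countable : Countable ⟦ σ ⟧
    covers    : ∀ x → ∃ λ V → V ∈ σ × x ∈ V
    notation  : IsNotation ν
    separated : ∀ x y → (x ≈ y) ⇔ (𝓟 X σ x ≐ 𝓟 X σ y)

record IsComputablePredicateSpace {k : ℕ} (X : Setoid a ℓ)
         (σ : Subset (Power X ℓ₁) ℓ₂) (ν : PartialMap k ⟦ σ ⟧)
       : Set (a ⊔ ℓ ⊔ lsuc ℓ₁ ⊔ ℓ₂) where
  field
    isEffectivePredicateSpace : IsEffectivePredicateSpace X σ ν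
    dom-computable            : Computable (dom ν)

------------------------------------------------------------------------
-- Real numbers, as Cauchy sequences of rationals

-- Close x x says that x is Cauchy; for Cauchy sequences x and y, Close x y
-- says that x m - y m tends to 0.
record Close (x y : ℕ → ℚ) : Set where
  constructor mkClose
  field
    close : ∀ ε → 0ℚ ℚ.< ε →
      ∃ λ N → ∀ m n → N ℕ.≤ m → N ℕ.≤ n → ∣ x m ℚ.- y n ∣ ℚ.< ε

open Close public

record ℝ : Set where
  no-eta-equality
  field
    seq    : ℕ → ℚ
    cauchy : Close seq seq

open ℝ public

infix 4 _≈ℝ_ _<ℝ_

record _≈ℝ_ (x y : ℝ) : Set where
  constructor mk≈
  field
    ≈-close : Close (seq x) (seq y)

record _<ℝ_ (x y : ℝ) : Set where
  constructor mk<
  field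
    gap          : ℚ
    gap-pos      : 0ℚ ℚ.< gap
    from         : ℕ
    gap-attained : ∀ m → from ℕ.≤ m → seq x m ℚ.+ gap ℚ.≤ seq y m

open _≈ℝ_ public
open _<ℝ_ public

half-pos : ∀ {e} → 0ℚ ℚ.< e → 0ℚ ℚ.< ½ ℚ.* e
half-pos {e} 0<e = subst (ℚ._< ½ ℚ.* e) (ℚₚ.*-zeroʳ ½) (ℚₚ.*-monoʳ-<-pos ½ 0<e)

halves : ∀ e → ½ ℚ.* e ℚ.+ ½ ℚ.* e ≡ e
halves = solve 1 (λ e → con ½ :* e :+ con ½ :* e := e) refl
  where open +-*-Solver

abs-swap : ∀ p q → ∣ p ℚ.- q ∣ ≡ ∣ q ℚ.- p ∣
abs-swap p q = trans (sym (ℚₚ.∣-p∣≡∣p∣ (p ℚ.- q)))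
  (cong ∣_∣ (solve 2 (λ p q → :- (p :- q) := q :- p) refl p q))
  where open +-*-Solver

≤∣_∣ : ∀ p → p ℚ.≤ ∣ p ∣
≤∣ p ∣ with ℚₚ.≤-total 0ℚ p
... | inj₁ 0≤p = ℚₚ.≤-reflexive (sym (ℚₚ.0≤p⇒∣p∣≡p 0≤p))
... | inj₂ p≤0 = ℚₚ.≤-trans p≤0 (ℚₚ.0≤∣p∣ p)

close-sym : ∀ {x y} → Close x y → Close y x
close-sym {x} {y} (mkClose xy) = mkClose λ e 0<e → let N , h = xy e 0<e in N , λ m n N≤m N≤n →
  subst (ℚ._< e) (abs-swap (x n) (y m)) (h n m N≤n N≤m)

close-trans : ∀ {x y z} → Close x y → Close y z → Close x z
close-trans {x} {y} {z} (mkClose xy) (mkClose yz) = mkClose λ e 0<e →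
  let N , h = xy (½ ℚ.* e) (half-pos 0<e)
      M , g = yz (½ ℚ.* e) (half-pos 0<e)
      K = N ℕ.⊔ M
      N≤K = ℕₚ.m≤m⊔n N M
      M≤K = ℕₚ.m≤n⊔m N M
  in K , λ m n K≤m K≤n → begin-strict
      ∣ x m ℚ.- z n ∣
        ≡⟨ cong ∣_∣ (solve 3 (λ a b c → a :- c := (a :- b) :+ (b :- c)) refl
             (x m) (y K) (z n)) ⟩
      ∣ (x m ℚ.- y K) ℚ.+ (y K ℚ.- z n) ∣
        ≤⟨ ℚₚ.∣p+q∣≤∣p∣+∣q∣ (x m ℚ.- y K) (y K ℚ.- z n) ⟩
      ∣ x m ℚ.- y K ∣ ℚ.+ ∣ y K ℚ.- z n ∣
        <⟨ ℚₚ.+-mono-< (h m K (ℕₚ.≤-trans N≤K K≤m) N≤K)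
                       (g K n M≤K (ℕₚ.≤-trans M≤K K≤n)) ⟩
      ½ ℚ.* e ℚ.+ ½ ℚ.* e
        ≡⟨ halves e ⟩
      e ∎
  where
  open ℚₚ.≤-Reasoning
  open +-*-Solver

close-+ : ∀ {x y x′ y′} → Close x x′ → Close y y′ →
          Close (λ m → x m ℚ.+ y m) (λ m → x′ m ℚ.+ y′ m)
close-+ {x} {y} {x′} {y′} (mkClose xx) (mkClose yy) = mkClose λ e 0<e →
  let N , h = xx (½ ℚ.* e) (half-pos 0<e)
      M , g = yy (½ ℚ.* e) (half-pos 0<e)
  in N ℕ.⊔ M , λ m n K≤m K≤n → begin-strict
      ∣ (x m ℚ.+ y m) ℚ.- (x′ n ℚ.+ y′ n) ∣
        ≡⟨ cong ∣_∣ (solve 4 (λ a b c d →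
             (a :+ b) :- (c :+ d) := (a :- c) :+ (b :- d)) refl
             (x m) (y m) (x′ n) (y′ n)) ⟩
      ∣ (x m ℚ.- x′ n) ℚ.+ (y m ℚ.- y′ n) ∣
        ≤⟨ ℚₚ.∣p+q∣≤∣p∣+∣q∣ (x m ℚ.- x′ n) (y m ℚ.- y′ n) ⟩
      ∣ x m ℚ.- x′ n ∣ ℚ.+ ∣ y m ℚ.- y′ n ∣
        <⟨ ℚₚ.+-mono-<
             (h m n (ℕₚ.≤-trans (ℕₚ.m≤m⊔n N M) K≤m) (ℕₚ.≤-trans (ℕₚ.m≤m⊔n N M) K≤n))
             (g m n (ℕₚ.≤-trans (ℕₚ.m≤n⊔m N M) K≤m) (ℕₚ.≤-trans (ℕₚ.m≤n⊔m N M) K≤n)) ⟩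
      ½ ℚ.* e ℚ.+ ½ ℚ.* e
        ≡⟨ halves e ⟩
      e ∎
  where
  open ℚₚ.≤-Reasoning
  open +-*-Solver

close-neg : ∀ {x x′} → Close x x′ → Close (λ m → ℚ.- x m) (λ m → ℚ.- x′ m)
close-neg {x} {x′} (mkClose xx) = mkClose λ e 0<e → let N , h = xx e 0<e in N , λ m n N≤m N≤n →
  subst (ℚ._< e)
    (trans (abs-swap (x m) (x′ n))
      (cong ∣_∣ (solve 2 (λ a b → b :- a := :- a :- (:- b)) refl (x m) (x′ n))))
    (h m n N≤m N≤n)
  where open +-*-Solver

eventually-bounded : ∀ {x x′} → Close x x′ →
  ∃ λ b → 0ℚ ℚ.< b × ∃ λ N → ∀ m → N ℕ.≤ m → ∣ x m ∣ ℚ.≤ b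
eventually-bounded {x} {x′} xx =
  let N , h = close xx 1ℚ (ℚₚ.positive⁻¹ 1ℚ) in
  1ℚ ℚ.+ ∣ x′ N ∣ , ℚₚ.+-mono-<-≤ (ℚₚ.positive⁻¹ 1ℚ) (ℚₚ.0≤∣p∣ (x′ N)) , N ,
  λ m N≤m → begin
    ∣ x m ∣
      ≡⟨ cong ∣_∣ (solve 2 (λ a b → a := (a :- b) :+ b) refl (x m) (x′ N)) ⟩
    ∣ (x m ℚ.- x′ N) ℚ.+ x′ N ∣
      ≤⟨ ℚₚ.∣p+q∣≤∣p∣+∣q∣ (x m ℚ.- x′ N) (x′ N) ⟩
    ∣ x m ℚ.- x′ N ∣ ℚ.+ ∣ x′ N ∣
      ≤⟨ ℚₚ.+-monoˡ-≤ ∣ x′ N ∣ (ℚₚ.<⇒≤ (h m N N≤m ℕₚ.≤-refl)) ⟩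
    1ℚ ℚ.+ ∣ x′ N ∣ ∎
  where
  open ℚₚ.≤-Reasoning
  open +-*-Solver

divide : ∀ b e → 0ℚ ℚ.< b → 0ℚ ℚ.< e → ∃ λ d → 0ℚ ℚ.< d × b ℚ.* d ≡ e
divide b e 0<b 0<e =
  1/b ℚ.* e ,
  subst (ℚ._< 1/b ℚ.* e) (ℚₚ.*-zeroʳ 1/b) (ℚₚ.*-monoʳ-<-pos 1/b 0<e) ,
  trans (sym (ℚₚ.*-assoc b 1/b e))
    (trans (cong (ℚ._* e) (ℚₚ.*-inverseʳ b)) (ℚₚ.*-identityˡ e))
  where
  instance
    b-pos : ℚ.Positive b
    b-pos = ℚ.positive 0<b
    b-nonZero : ℚ.NonZero b
    b-nonZero = ℚₚ.pos⇒nonZero b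
  1/b = ℚ.1/ b
  instance
    1/b-pos : ℚ.Positive 1/b
    1/b-pos = ℚₚ.1/pos⇒pos b

close-* : ∀ {x y x′ y′} → Close x x′ → Close y y′ →
          Close (λ m → x m ℚ.* y m) (λ m → x′ m ℚ.* y′ m)
close-* {x} {y} {x′} {y′} xx yy = mkClose λ e 0<e →
  let b , 0<b , N₁ , bx = eventually-bounded xx
      c , 0<c , N₂ , cy = eventually-bounded (close-sym yy)
      d , 0<d , bd = divide b (½ ℚ.* e) 0<b (half-pos 0<e)
      f , 0<f , cf = divide c (½ ℚ.* e) 0<c (half-pos 0<e)
      N₃ , h = close xx f 0<f
      N₄ , g = close yy d 0<d
      M₁ = N₁ ℕ.⊔ N₂
      M₂ = N₃ ℕ.⊔ N₄
      below₁ = λ {m} (p : M₁ ℕ.⊔ M₂ ℕ.≤ m) → ℕₚ.m⊔n≤o⇒m≤o N₁ N₂ (ℕₚ.m⊔n≤o⇒m≤o M₁ M₂ p)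
      below₂ = λ {m} (p : M₁ ℕ.⊔ M₂ ℕ.≤ m) → ℕₚ.m⊔n≤o⇒n≤o N₁ N₂ (ℕₚ.m⊔n≤o⇒m≤o M₁ M₂ p)
      below₃ = λ {m} (p : M₁ ℕ.⊔ M₂ ℕ.≤ m) → ℕₚ.m⊔n≤o⇒m≤o N₃ N₄ (ℕₚ.m⊔n≤o⇒n≤o M₁ M₂ p)
      below₄ = λ {m} (p : M₁ ℕ.⊔ M₂ ℕ.≤ m) → ℕₚ.m⊔n≤o⇒n≤o N₃ N₄ (ℕₚ.m⊔n≤o⇒n≤o M₁ M₂ p)
  in M₁ ℕ.⊔ M₂ , λ m n K≤m K≤n → begin-strict
      ∣ x m ℚ.* y m ℚ.- x′ n ℚ.* y′ n ∣
        ≡⟨ cong ∣_∣ (solve 4 (λ p q r s →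
             p :* q :- r :* s := p :* (q :- s) :+ s :* (p :- r)) refl
             (x m) (y m) (x′ n) (y′ n)) ⟩
      ∣ x m ℚ.* (y m ℚ.- y′ n) ℚ.+ y′ n ℚ.* (x m ℚ.- x′ n) ∣
        ≤⟨ ℚₚ.∣p+q∣≤∣p∣+∣q∣ (x m ℚ.* (y m ℚ.- y′ n)) (y′ n ℚ.* (x m ℚ.- x′ n)) ⟩
      ∣ x m ℚ.* (y m ℚ.- y′ n) ∣ ℚ.+ ∣ y′ n ℚ.* (x m ℚ.- x′ n) ∣
        <⟨ ℚₚ.+-mono-<
             (bound {q = y m ℚ.- y′ n} 0<b (bx m (below₁ K≤m)) bd (g m n (below₄ K≤m) (below₄ K≤n)))
             (bound {q = x m ℚ.- x′ n} 0<c (cy n (below₂ K≤n)) cf (h m n (below₃ K≤m) (below₃ K≤n))) ⟩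
      ½ ℚ.* e ℚ.+ ½ ℚ.* e
        ≡⟨ halves e ⟩
      e ∎
  where
  open ℚₚ.≤-Reasoning
  open +-*-Solver
  bound : ∀ {b p q d t} → 0ℚ ℚ.< b → ∣ p ∣ ℚ.≤ b → b ℚ.* d ≡ t →
          ∣ q ∣ ℚ.< d → ∣ p ℚ.* q ∣ ℚ.< t
  bound {b} {p} {q} {d} {t} 0<b p≤b bd q<d = begin-strict
    ∣ p ℚ.* q ∣
      ≡⟨ ℚₚ.∣p*q∣≡∣p∣*∣q∣ p q ⟩
    ∣ p ∣ ℚ.* ∣ q ∣
      ≤⟨ ℚₚ.*-monoʳ-≤-nonNeg ∣ q ∣ {{ℚ.nonNegative (ℚₚ.0≤∣p∣ q)}} p≤b ⟩
    b ℚ.* ∣ q ∣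
      <⟨ ℚₚ.*-monoʳ-<-pos b {{ℚ.positive 0<b}} q<d ⟩
    b ℚ.* d
      ≡⟨ bd ⟩
    t ∎

infixl 6 _+ℝ_ _-ℝ_
infixl 7 _*ℝ_

_+ℝ_ _*ℝ_ _-ℝ_ : ℝ → ℝ → ℝ
seq (x +ℝ y) m = seq x m ℚ.+ seq y m
cauchy (x +ℝ y) = close-+ (cauchy x) (cauchy y)
seq (x *ℝ y) m = seq x m ℚ.* seq y m
cauchy (x *ℝ y) = close-* (cauchy x) (cauchy y)
seq (x -ℝ y) m = seq x m ℚ.- seq y m
cauchy (x -ℝ y) = close-+ (cauchy x) (close-neg (cauchy y))

+ℝ-cong : ∀ {x y x′ y′} → x ≈ℝ x′ → y ≈ℝ y′ → x +ℝ y ≈ℝ x′ +ℝ y′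
+ℝ-cong {x} {y} {x′} {y′} (mk≈ xx) (mk≈ yy) =
  mk≈ (close-+ {seq x} {seq y} {seq x′} {seq y′} xx yy)

*ℝ-cong : ∀ {x y x′ y′} → x ≈ℝ x′ → y ≈ℝ y′ → x *ℝ y ≈ℝ x′ *ℝ y′
*ℝ-cong {x} {y} {x′} {y′} (mk≈ xx) (mk≈ yy) =
  mk≈ (close-* {seq x} {seq y} {seq x′} {seq y′} xx yy)

-ℝ-cong : ∀ {x y x′ y′} → x ≈ℝ x′ → y ≈ℝ y′ → x -ℝ y ≈ℝ x′ -ℝ y′
-ℝ-cong {x} {y} {x′} {y′} (mk≈ xx) (mk≈ yy) =
  mk≈ (close-+ {seq x} {λ m → ℚ.- seq y m} {seq x′} {λ m → ℚ.- seq y′ m}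
    xx (close-neg yy))

fromℚ : ℚ → ℝ
seq (fromℚ q) m = q
cauchy (fromℚ q) = mkClose λ e 0<e → 0 , λ _ _ _ _ →
  subst (λ z → ∣ z ∣ ℚ.< e) (sym (ℚₚ.+-inverseʳ q)) 0<e

0ℝ : ℝ
0ℝ = fromℚ 0ℚ

ℝ-setoid : Setoid 0ℓ 0ℓ
ℝ-setoid = record
  { Carrier = ℝ
  ; _≈_ = _≈ℝ_
  ; isEquivalence = record
    { refl = λ {x} → mk≈ (cauchy x)
    ; sym = λ (mk≈ xy) → mk≈ (close-sym xy)
    ; trans = λ (mk≈ xy) (mk≈ yz) → mk≈ (close-trans xy yz)
    }
  }

<ℝ-respˡ-≈ : ∀ {x x′ y} → x ≈ℝ x′ → x <ℝ y → x′ <ℝ y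
<ℝ-respˡ-≈ {x} {x′} {y} (mk≈ (mkClose xx)) (mk< e 0<e M x+e≤y) =
  let N , h = xx (½ ℚ.* e) (half-pos 0<e) in
  mk< (½ ℚ.* e) (half-pos 0<e) (N ℕ.⊔ M) λ m K≤m →
    let N≤m = ℕₚ.m⊔n≤o⇒m≤o N M K≤m
        M≤m = ℕₚ.m⊔n≤o⇒n≤o N M K≤m
    in begin
      seq x′ m ℚ.+ ½ ℚ.* e
        ≡⟨ solve 3 (λ a b d → a :+ d := b :+ ((a :- b) :+ d)) refl
             (seq x′ m) (seq x m) (½ ℚ.* e) ⟩
      seq x m ℚ.+ ((seq x′ m ℚ.- seq x m) ℚ.+ ½ ℚ.* e)
        ≤⟨ ℚₚ.+-monoʳ-≤ (seq x m) (ℚₚ.+-monoˡ-≤ (½ ℚ.* e)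
             (ℚₚ.≤-trans ≤∣ seq x′ m ℚ.- seq x m ∣
               (ℚₚ.≤-trans (ℚₚ.≤-reflexive (abs-swap (seq x′ m) (seq x m)))
                 (ℚₚ.<⇒≤ (h m m N≤m N≤m))))) ⟩
      seq x m ℚ.+ (½ ℚ.* e ℚ.+ ½ ℚ.* e)
        ≡⟨ cong (seq x m ℚ.+_) (halves e) ⟩
      seq x m ℚ.+ e
        ≤⟨ x+e≤y m M≤m ⟩
      seq y m ∎
  where
  open ℚₚ.≤-Reasoning
  open +-*-Solver

------------------------------------------------------------------------
-- Euclidean space

infix 8 ℝ^_

ℝ^_ : ℕ → Setoid 0ℓ 0ℓ
ℝ^ n = VectorEq.≋-setoid ℝ-setoid n

dist² : ∀ {n} → Vector ℝ n → Vector ℝ n → ℝ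
dist² x y = Vector.foldr _+ℝ_ 0ℝ (λ i → (x i -ℝ y i) *ℝ (x i -ℝ y i))

dist²-congˡ : ∀ {n} {x x′ : Vector ℝ n} (y : Vector ℝ n) →
              (∀ i → x i ≈ℝ x′ i) → dist² x y ≈ℝ dist² x′ y
dist²-congˡ {zero} y e = mk≈ (cauchy 0ℝ)
dist²-congˡ {suc n} {x} {x′} y e = +ℝ-cong
    (*ℝ-cong e₀ e₀)
    (dist²-congˡ {x = λ i → x (suc i)} {λ i → x′ (suc i)}
      (λ i → y (suc i)) (λ i → e (suc i)))
  where
  e₀ : x zero -ℝ y zero ≈ℝ x′ zero -ℝ y zero
  e₀ = -ℝ-cong (e zero) (mk≈ (cauchy (y zero)))

-- The Euclidean ball of radius r; used only for r > 0, where ∥ x - c ∥ < r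
-- amounts to ∥ x - c ∥² < r².
Ball : ∀ {n} → Vector ℝ n → ℝ → Subset (ℝ^ n) 0ℓ
pred (Ball c r) x = dist² x c <ℝ r *ℝ r
resp (Ball c r) {x} {x′} e =
  <ℝ-respˡ-≈ (dist²-congˡ {x = x} {x′} c e)

Open : ∀ {n} → Subset (ℝ^ n) ℓ → Set ℓ
Open {n = n} A = ∀ {x} → x ∈ A → ∃ λ r → 0ℝ <ℝ r × Ball x r ⊆ A

RationalBalls : ∀ n → Subset (Power (ℝ^ n) 0ℓ) 0ℓ
pred (RationalBalls n) V = Σ[ c ∈ Vector ℚ n ] ∃ λ r →
  0ℚ ℚ.< r × V ≐ Ball (λ i → fromℚ (c i)) (fromℚ r)
resp (RationalBalls n) (V⊆W , W⊆V) (c , r , 0<r , V⊆B , B⊆V) =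
  c , r , 0<r , (λ x → V⊆B (W⊆V x)) , (λ x → V⊆W (B⊆V x))

module _ {n m} {A : Subset (ℝ^ n) ℓ₁} {B : Subset (ℝ^ m) ℓ₂} where

  Continuous : Func ⟦ A ⟧ ⟦ B ⟧ → Set ℓ₁
  Continuous f = ∀ x ε → 0ℝ <ℝ ε → ∃ λ δ → 0ℝ <ℝ δ × (∀ y →
      proj₁ y ∈ Ball (proj₁ x) δ → proj₁ (to y) ∈ Ball (proj₁ (to x)) ε)
    where open Func f

IsHomeomorphism : ∀ {n m} {A : Subset (ℝ^ n) ℓ₁} {B : Subset (ℝ^ m) ℓ₂} →
                  Func ⟦ A ⟧ ⟦ B ⟧ → Set (ℓ₁ ⊔ ℓ₂)
IsHomeomorphism {A = A} {B} f = Σ[ g ∈ Func ⟦ B ⟧ ⟦ A ⟧ ]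
  Inverseᵇ (Setoid._≈_ ⟦ A ⟧) (Setoid._≈_ ⟦ B ⟧) (Func.to f) (Func.to g) ×
  Continuous {A = A} {B} f × Continuous {A = B} {A} g

------------------------------------------------------------------------
-- Atlases

image : ∀ {X : Setoid a ℓ} (U : Subset X ℓ₁) {n} →
        Injection ⟦ U ⟧ (ℝ^ n) → Subset X ℓ₂ → Subset (ℝ^ n) (a ⊔ ℓ₁ ⊔ ℓ₂)
image U {n} φ A = record
  { pred = λ v → ∃ λ x → proj₁ x ∈ A × to x ≈ v
  ; resp = λ e (x , x∈A , φx≈v) → x , x∈A , ≈-trans φx≈v e
  }
  where
  open Injection φ using (to)
  open Setoid (ℝ^ n) using (_≈_) renaming (trans to ≈-trans)

-- A bijection of U onto an open subset of ℝⁿ.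
record Chart (X : Setoid ℓ ℓ) (n : ℕ) : Set (lsuc ℓ) where
  field
    U          : Subset X ℓ
    φ          : Injection ⟦ U ⟧ (ℝ^ n)
    open-image : Open (image U φ U)

  open Injection φ public using (to; cong; injective)

module _ {X : Setoid ℓ ℓ} {n} (C D : Chart X n) where
  private
    module C = Chart C
    module D = Chart D
    open Setoid (ℝ^ n) using (_≈_) renaming (refl to ≈-refl; sym to ≈-sym; trans to ≈-trans)

  -- φ_D φ_C⁻¹ : φ_C[U_C ∩ U_D] → φ_D[U_C ∩ U_D]; the inverse image under φ_C
  -- is the point provided by membership in the image, unique by injectivity.
  transition : Func ⟦ image C.U C.φ (C.U ∩ D.U) ⟧ ⟦ image D.U D.φ (C.U ∩ D.U) ⟧
  transition = record
    { to = λ (_ , (x , _) , (x∈C , x∈D) , _) →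
        D.to (x , x∈D) , (x , x∈D) , (x∈C , x∈D) , ≈-refl
    ; cong = λ { {_ , _ , _ , φx≈v} {_ , _ , _ , φy≈w} v≈w →
        D.cong (C.injective (≈-trans φx≈v (≈-trans v≈w (≈-sym φy≈w)))) }
    }

record Atlas (k n : ℕ) (X : Setoid ℓ ℓ) : Set (lsuc ℓ) where
  field
    I            : Pred (Word k) ℓ
    I-irrelevant : Irrelevant I
    chart        : ∀ i → I i → Chart X n

  U : ∀ i → I i → Subset X ℓ
  U i p = Chart.U (chart i p)

  φ : ∀ i (p : I i) → Injection ⟦ U i p ⟧ (ℝ^ n)
  φ i p = Chart.φ (chart i p)

  field
    covers : ∀ x → ∃₂ λ i p → x ∈ U i p
    open-overlap : ∀ i p j q → Open (image (U i p) (φ i p) (U i p ∩ U j q))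
    transition-homeomorphism : ∀ i p j q →
      IsHomeomorphism
        {A = image (U i p) (φ i p) (U i p ∩ U j q)} {B = image (U j q) (φ j q) (U i p ∩ U j q)}
        (transition (chart i p) (chart j q))

------------------------------------------------------------------------
-- Computable balls

module _ {k n : ℕ} {X : Setoid ℓ ℓ}
         (μ : PartialMap k ⟦ RationalBalls n ⟧) (Φ : Atlas k n X) where
  private
    module Φ = Atlas Φ

  ball : ∀ w → dom μ w → Subset (ℝ^ n) 0ℓ
  ball w p = proj₁ (app μ w p)

  -- φ_i⁻¹[μ(w)], with the condition "i ∈ I and μ(w) ⊆ φ_i[U_i]" conjoined to
  -- membership, so that the set is empty when the condition fails.
  B : ∀ i w → dom μ w → Subset X ℓ
  pred (B i w p) x = Σ[ i∈I ∈ Φ.I i ]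
    ball w p ⊆ image (Φ.U i i∈I) (Φ.φ i i∈I) (Φ.U i i∈I) ×
    Σ[ x∈U ∈ x ∈ Φ.U i i∈I ] Injection.to (Φ.φ i i∈I) (x , x∈U) ∈ ball w p
  resp (B i w p) x≈y (i∈I , sub , x∈U , φx∈B) =
    i∈I , sub , resp (Φ.U i i∈I) x≈y x∈U ,
    resp (ball w p) (Injection.cong (Φ.φ i i∈I) x≈y) φx∈B

  𝓑 : Subset (Power X ℓ) ℓ
  pred 𝓑 V = ∃₂ λ i w → ∃ λ p → V ≐ B i w p
  resp 𝓑 (V⊆W , W⊆V) (i , w , p , V⊆B , B⊆V) =
    i , w , p , (λ x → V⊆B (W⊆V x)) , (λ x → V⊆W (B⊆V x))

  B-irr : ∀ i w p q → B i w p ⊆ B i w q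
  B-irr i w p q (i∈I , sub , x∈U , φx∈B) =
    i∈I , (λ v → sub (proj₂ (app-irr μ p q) v)) , x∈U ,
    proj₁ (app-irr μ p q) φx∈B

  λΦ : PartialMap k ⟦ 𝓑 ⟧
  dom λΦ z = ∃₂ λ i w → dom μ w × z ≡ ⟨ i , w ⟩
  app λΦ _ (i , w , p , _) = B i w p , i , w , p , (λ x → x) , (λ x → x)
  app-irr λΦ (i , w , p , refl) (i′ , w′ , q , e)
    with refl , refl ← ⟨,⟩-injective {u = i} {w} {i′} {w′} e
    = (λ {x} → B-irr i w p q {x}) , (λ {x} → B-irr i w q p {x})

{-# OPTIONS --safe #-}

-- Being a pair ⟨ u , v ⟩ with v in a decidable set is decided by a
-- finite automaton with output, which also makes the family of balls countable.
-- Around a chart value one finds rational balls, inside the open image of the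
-- chart, that are as small as desired; they cover X.  A point that lies in all
-- those around φ x is in the domain of the same chart and has the same chart
-- value as x, hence is equal to x.

module Submission where

open import Defs
open import Level using (Level)
open import Data.Bool using (if_then_else_)
open import Data.Empty using (⊥-elim)
open import Data.Fin using (Fin; zero; suc; toℕ)
import Data.Fin.Properties as Finₚ
open import Data.List as List using (List; []; _∷_; _++_)
import Data.List.Properties as Listₚ
open import Data.Maybe using (Maybe; just; nothing)
open import Data.Nat as ℕ using (ℕ; zero; suc)
import Data.Nat.Divisibility as ℕ
open import Data.Nat.DivMod as ℕ using (_%_; _/_; _mod_)
import Data.Nat.Properties as ℕₚ
open import Data.Product using (Σ-syntax; ∃; ∃₂; _×_; _,_; proj₁; proj₂)
import Data.Product.Properties as Productₚ
open import Data.Rational as ℚ using (ℚ; 0ℚ; 1ℚ; ½; ∣_∣)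
import Data.Rational.Properties as ℚₚ
open import Data.Rational.Solver using (module +-*-Solver)
open import Data.Sum using (_⊎_; inj₁; inj₂)
open import Data.Vec using ([]; _∷_)
open import Data.Vec.Functional using (Vector)
open import Data.Vec.Relation.Binary.Pointwise.Inductive using ([]; _∷_)
open import Function using (Injection; mk⇔; _∘_)
open import Relation.Binary using (Setoid)
open import Relation.Binary.PropositionalEquality
  using (_≡_; _≢_; refl; sym; trans; cong; cong₂; subst; module ≡-Reasoning)
open import Relation.Nullary using (Dec; yes; no; does; contradiction)
open import Relation.Unary using (Pred; Decidable)

private variable
  a ℓ : Level
  k : ℕ

-- Words and computability

computable⇒decidable : {D : Pred (Word k) ℓ} → Computable D → Decidable D
computable⇒decidable (_ , decide) w with decide w
... | inj₁ (w∈D , _) = yes w∈D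
... | inj₂ (w∉D , _) = no w∉D

-- Bijective numeration in base 2 + k, least significant digit first: the letter `l` is the digit
-- `toℕ l` + 1, and the empty word is 0.
wordIndex : Word k → ℕ
wordIndex [] = 0
wordIndex {k} (l ∷ w) = suc (toℕ l ℕ.+ wordIndex w ℕ.* (2 ℕ.+ k))

-- The first argument is fuel; the value of the second argument suffices.
wordAt : ℕ → ℕ → Word k
wordAt zero _ = []
wordAt (suc _) zero = []
wordAt {k} (suc f) (suc m) = m mod (2 ℕ.+ k) ∷ wordAt f (m / (2 ℕ.+ k))

wordAt-wordIndex : ∀ f (w : Word k) → wordIndex w ℕ.≤ f → wordAt f (wordIndex w) ≡ w
wordAt-wordIndex zero [] _ = refl
wordAt-wordIndex (suc _) [] _ = refl
wordAt-wordIndex {k} (suc f) (l ∷ w) (ℕ.s≤s m≤f) =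
  cong₂ _∷_ head≡ (trans (cong (wordAt f) quotient) (wordAt-wordIndex f w n≤f))
  where
  n b : ℕ
  n = wordIndex w
  b = 2 ℕ.+ k
  head≡ : (toℕ l ℕ.+ n ℕ.* b) mod b ≡ l
  head≡ = Finₚ.toℕ-injective (begin
    toℕ ((toℕ l ℕ.+ n ℕ.* b) mod b)  ≡⟨ Finₚ.toℕ-fromℕ< _ ⟩
    (toℕ l ℕ.+ n ℕ.* b) % b          ≡⟨ ℕ.[m+kn]%n≡m%n (toℕ l) n b ⟩
    toℕ l % b                        ≡⟨ ℕ.m<n⇒m%n≡m (Finₚ.toℕ<n l) ⟩
    toℕ l                            ∎)
    where open ≡-Reasoning
  quotient : (toℕ l ℕ.+ n ℕ.* b) / b ≡ n
  quotient = begin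
    (toℕ l ℕ.+ n ℕ.* b) / b      ≡⟨ ℕ.+-distrib-/-∣ʳ (toℕ l) (ℕ.n∣m*n n) ⟩
    toℕ l / b ℕ.+ n ℕ.* b / b    ≡⟨ cong₂ ℕ._+_ (ℕ.m<n⇒m/n≡0 (Finₚ.toℕ<n l)) (ℕ.m*n/n≡m n b) ⟩
    n                            ∎
    where open ≡-Reasoning
  n≤f : n ℕ.≤ f
  n≤f = ℕₚ.≤-trans (ℕₚ.m≤m*n n b) (ℕₚ.≤-trans (ℕₚ.m≤n+m _ (toℕ l)) m≤f)

notation⇒countable : {S : Setoid a ℓ} (ν : PartialMap k S) →
                     IsNotation ν → Decidable (dom ν) → Countable S
notation⇒countable {k = k} {S = S} ν notation dom? = enumerate ∘ word , surjective
  where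
  open Setoid S using (Carrier; _≈_)
  word : ℕ → Word k
  -- The number itself is enough fuel for decoding it.
  word n = wordAt n n
  enumerate : Word k → Maybe Carrier
  enumerate w with dom? w
  ... | yes p = just (app ν w p)
  ... | no  _ = nothing
  -- The membership proof `q` found by `dom?` may differ from `p`; `app-irr` makes up for this
  -- below.
  enumerate-dom : ∀ w (p : dom ν w) → ∃ λ q → enumerate w ≡ just (app ν w q)
  enumerate-dom w p with dom? w
  ... | yes q = q , refl
  ... | no ¬p = ⊥-elim (¬p p)
  surjective : ∀ s → ∃₂ λ n t → enumerate (word n) ≡ just t × t ≈ s
  surjective s =
    let w , p , νw≈s = notation s
        q , e = enumerate-dom w p
    in wordIndex w , app ν w q ,
       trans (cong enumerate (wordAt-wordIndex (wordIndex w) w ℕₚ.≤-refl)) e ,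
       Setoid.trans S (app-irr ν q p) νw≈s

-- Case distinction by recursive functions

Total : Rec k 1 → Set
Total {k} f = ∀ w → ∃ λ z → f [ w ∷ [] ]⇓ z

prepend : ∀ {n} → Word k → Rec k n → Rec k n
prepend [] f = f
prepend (l ∷ w) f = comp (cons l) (prepend w f ∷ [])

prepend⇓ : ∀ {n} {f : Rec k n} {xs z} w → f [ xs ]⇓ z → prepend w f [ xs ]⇓ w ++ z
prepend⇓ [] f⇓ = f⇓
prepend⇓ (l ∷ w) f⇓ = comp⇓ (prepend⇓ w f⇓ ∷ []) cons⇓

unary : ∀ {m} → Fin m → Word k → Word k
unary zero w = 𝟏 ∷ w
unary (suc i) w = 𝟎 ∷ unary i w

-- Strips the self-delimiting prefix 0ⁱ1 made by `unary` and continues with branch i. Recursion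
-- serves only to inspect the first letter: the tail is used, the recursive value dropped. The
-- values `ε` are defaults without influence on words `unary i w`.
dispatch : ∀ m → (Fin m → Rec k 1) → Rec k 1
dispatch zero f = ε
dispatch (suc m) f = prec ε λ
  { zero    → comp (dispatch m (f ∘ suc)) (proj zero ∷ [])
  ; (suc _) → comp (f zero) (proj zero ∷ [])
  }

-- `prec` evaluates the recursive call even where its value is dropped, so one branch gives a result
-- only if the others converge as well.
dispatch-total : ∀ m {f : Fin m → Rec k 1} → (∀ i → Total (f i)) → Total (dispatch m f)
dispatch-total zero f-total w = [] , ε⇓
dispatch-total (suc m) f-total [] = [] , prec-[]⇓ ε⇓
dispatch-total (suc m) f-total (zero ∷ w) =
  let _ , rest⇓ = dispatch-total (suc m) f-total w
      z , f⇓    = dispatch-total m (f-total ∘ suc) w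
  in z , prec-∷⇓ rest⇓ (comp⇓ (proj⇓ ∷ []) f⇓)
dispatch-total (suc m) f-total (suc _ ∷ w) =
  let _ , rest⇓ = dispatch-total (suc m) f-total w
      z , f⇓    = f-total zero w
  in z , prec-∷⇓ rest⇓ (comp⇓ (proj⇓ ∷ []) f⇓)

dispatch⇓ : ∀ {m} {f : Fin m → Rec k 1} {w z} → (∀ i → Total (f i)) →
            ∀ i → f i [ w ∷ [] ]⇓ z → dispatch m f [ unary i w ∷ [] ]⇓ z
dispatch⇓ {m = suc m} {w = w} f-total zero f⇓ =
  prec-∷⇓ (proj₂ (dispatch-total (suc m) f-total w)) (comp⇓ (proj⇓ ∷ []) f⇓)
dispatch⇓ {m = suc m} {w = w} f-total (suc i) f⇓ =
  prec-∷⇓ (proj₂ (dispatch-total (suc m) f-total (unary i w)))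
    (comp⇓ (proj⇓ ∷ []) (dispatch⇓ (f-total ∘ suc) i f⇓))

-- A finite automaton that reads ⟨ u , v ⟩ from right to left, the order in
-- which `prec` consumes a word, and collects v.

Phase State Control : Set
Phase = Fin 2
State = Fin 8
Control = Phase × State

pattern first  = zero
pattern second = suc zero

pattern fresh    = zero
pattern end₁     = suc zero
pattern end₂     = suc (suc zero)
pattern boundary = suc (suc (suc zero))
pattern inside   = suc (suc (suc (suc zero)))
-- The letter 1 has been read: it is a letter of the word if 0 comes next, and
-- belongs to the initial 11 if 1 does.
pattern inside₁  = suc (suc (suc (suc (suc zero))))
pattern final    = suc (suc (suc (suc (suc (suc zero)))))
pattern dead     = suc (suc (suc (suc (suc (suc (suc zero))))))

next : Phase → Control
next first  = second , fresh
next second = second , final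

-- Phases follow the reading order: `first` is spent on the right component, which is kept, and
-- `second` on the left one, which is only checked.
collect : Phase → Letter k → Word k
collect first  l = l ∷ []
collect second l = []

-- The second component is put in front of the word collected so far.
δ : Letter k → Control → Control × Word k
δ (suc zero) (p , fresh)    = (p , end₁) , []
δ (suc zero) (p , end₁)     = (p , end₂) , []
δ zero       (p , end₂)     = (p , boundary) , []
δ (suc zero) (p , boundary) = (p , inside₁) , []
δ l          (p , boundary) = (p , inside) , collect p l
δ zero       (p , inside)   = (p , boundary) , []
δ zero       (p , inside₁)  = (p , boundary) , collect p 𝟏
δ (suc zero) (p , inside₁)  = next p , []
-- This includes every letter read after `final`: nothing may precede the pair.
δ _          (p , _)        = (p , dead) , []

Configuration : ℕ → Set
Configuration k = Control × Word k

step : Letter k → Configuration k → Configuration k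
step l (c , v) = proj₁ (δ l c) , proj₂ (δ l c) ++ v

run : Word k → Configuration k
run = List.foldr step ((first , fresh) , [])

-- Correctness of the automaton

code : Word k → Word k
code w = List.concatMap (λ x → 𝟎 ∷ x ∷ []) w ++ 𝟎 ∷ 𝟏 ∷ 𝟏 ∷ []

store : Phase → Word k → Word k → Word k
store first  c v = c ++ v
store second c v = v

collect-store : ∀ p (x : Letter k) {c v} → collect p x ++ store p c v ≡ store p (x ∷ c) v
collect-store first  x = refl
collect-store second x = refl

-- The letter 1 takes a detour through `inside₁` and is collected only at the following 0; every
-- other letter is collected at once.
step-letter : ∀ p (x : Letter k) v →
              step 𝟎 (step x ((p , boundary) , v)) ≡ ((p , boundary) , collect p x ++ v)
step-letter p zero          v = refl
step-letter p (suc zero)    v = refl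
step-letter p (suc (suc _)) v = refl

run-code : ∀ p c {t v : Word k} → run t ≡ ((p , fresh) , v) →
           run (code c ++ t) ≡ ((p , boundary) , store p c v)
run-code first  [] e = cong (step 𝟎 ∘ step 𝟏 ∘ step 𝟏) e
run-code second [] e = cong (step 𝟎 ∘ step 𝟏 ∘ step 𝟏) e
run-code p (x ∷ c) {t} {v} e = begin
  step 𝟎 (step x (run (code c ++ t)))               ≡⟨ cong (step 𝟎 ∘ step x) (run-code p c e) ⟩
  step 𝟎 (step x ((p , boundary) , store p c v))    ≡⟨ step-letter p x _ ⟩
  ((p , boundary) , collect p x ++ store p c v)     ≡⟨ cong (_ ,_) (collect-store p x) ⟩
  ((p , boundary) , store p (x ∷ c) v)              ∎
  where open ≡-Reasoning

run-ι : ∀ p c {t v : Word k} → run t ≡ ((p , fresh) , v) →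
        run (ι c ++ t) ≡ (next p , store p c v)
run-ι p c e = cong (step 𝟏 ∘ step 𝟏) (run-code p c e)

run-⟨,⟩ : ∀ (u v : Word k) → run ⟨ u , v ⟩ ≡ ((second , final) , v)
run-⟨,⟩ u v = run-ι second u (begin
  run (ι v)                      ≡⟨ cong run (Listₚ.++-identityʳ (ι v)) ⟨
  run (ι v ++ [])                ≡⟨ run-ι first v refl ⟩
  ((second , fresh) , v ++ [])   ≡⟨ cong (_ ,_) (Listₚ.++-identityʳ v) ⟩
  ((second , fresh) , v)         ∎)
  where open ≡-Reasoning

-- Reading t s c z: in state s, the automaton has read z, which consists of t
-- and a final segment of ι applied to a word that ends with c.
data Reading (t : Word k) : State → Word k → Word k → Set where
  at-fresh    : Reading t fresh [] t
  at-end₁     : Reading t end₁ [] (𝟏 ∷ t)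
  at-end₂     : Reading t end₂ [] (𝟏 ∷ 𝟏 ∷ t)
  at-boundary : ∀ {c} → Reading t boundary c (code c ++ t)
  at-inside   : ∀ {c} x → Reading t inside (x ∷ c) (x ∷ code c ++ t)
  at-inside₁  : ∀ {c} → Reading t inside₁ c (𝟏 ∷ code c ++ t)

-- What lies to the right of the component being read, together with the word collected from it.
data Base {k} : Phase → Word k → Word k → Set where
  in-first  : Base first [] []
  in-second : ∀ {v} → Base second v (ι v)

-- The invariant for soundness: the configuration determines the shape of what has been read, except
-- that a dead one claims nothing.
data Reached {k} : Configuration k → Word k → Set where
  reading  : ∀ {p s t c v z} → Base p v t → Reading t s c z → Reached ((p , s) , store p c v) z
  finished : ∀ {v} u → Reached ((second , final) , v) ⟨ u , v ⟩
  rejected : ∀ {p v z} → Reached ((p , dead) , v) z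

next-reached : ∀ {p} {v t : Word k} c → Base p v t → Reached (next p , store p c v) (ι c ++ t)
-- To the right of the first component there is only the empty word, which leaves a trailing `++ []`
-- in both indices.
next-reached c in-first rewrite Listₚ.++-identityʳ c | Listₚ.++-identityʳ (ι c) =
  reading {c = []} in-second at-fresh
next-reached c in-second = finished c

-- While the phase is a variable, the output of `δ` does not reduce to the form `store p c v` that
-- `reading` demands.
collected : ∀ {p s} {t v z : Word k} x {c} → Base p v t → Reading t s (x ∷ c) z →
            Reached ((p , s) , collect p x ++ store p c v) z
collected {p = p} {v = v} x {c} b r rewrite collect-store p x {c} {v} = reading b r

step-reached : ∀ l {c} {z : Word k} → Reached c z → Reached (step l c) (l ∷ z)
step-reached zero          (reading b at-fresh)          = rejected
step-reached (suc zero)    (reading b at-fresh)          = reading b at-end₁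
step-reached (suc (suc _)) (reading b at-fresh)          = rejected
step-reached zero          (reading b at-end₁)           = rejected
step-reached (suc zero)    (reading b at-end₁)           = reading b at-end₂
step-reached (suc (suc _)) (reading b at-end₁)           = rejected
step-reached zero          (reading b at-end₂)           = reading b at-boundary
step-reached (suc zero)    (reading b at-end₂)           = rejected
step-reached (suc (suc _)) (reading b at-end₂)           = rejected
step-reached zero          (reading b at-boundary)       = collected zero b (at-inside zero)
step-reached (suc zero)    (reading b at-boundary)       = reading b at-inside₁
step-reached (suc (suc x)) (reading b at-boundary)       = collected (suc (suc x)) b (at-inside _)
step-reached zero          (reading b (at-inside x))     = reading b at-boundary
step-reached (suc zero)    (reading b (at-inside x))     = rejected
step-reached (suc (suc _)) (reading b (at-inside x))     = rejected
step-reached zero          (reading b at-inside₁)        = collected 𝟏 b at-boundary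
step-reached (suc zero)    (reading b (at-inside₁ {c}))  = next-reached c b
step-reached (suc (suc _)) (reading b at-inside₁)        = rejected
step-reached zero          (finished u)                  = rejected
step-reached (suc zero)    (finished u)                  = rejected
step-reached (suc (suc _)) (finished u)                  = rejected
step-reached zero          rejected                      = rejected
step-reached (suc zero)    rejected                      = rejected
step-reached (suc (suc _)) rejected                      = rejected

run-reached : ∀ (z : Word k) → Reached (run z) z
run-reached [] = reading {c = []} in-first at-fresh
run-reached (l ∷ z) = step-reached l (run-reached z)

-- Only `finished` has the state `final`: `Reading` stops at `inside₁`, and `rejected` is dead.
run-final : ∀ (z : Word k) {v} → run z ≡ ((second , final) , v) → ∃ λ u → z ≡ ⟨ u , v ⟩
run-final z e with run z | run-reached z
run-final _ refl | _ | finished u = u , refl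

-- The automaton as a recursive function

encode : Configuration k → Word k
encode ((p , s) , v) = unary p (unary s v)

branch : (Control → Rec k 1) → Rec k 1
branch f = dispatch 2 λ p → dispatch 8 λ s → f (p , s)

branch⇓ : ∀ {f : Control → Rec k 1} → (∀ c → Total (f c)) →
          ∀ c {v z} → f c [ v ∷ [] ]⇓ z → branch f [ encode (c , v) ∷ [] ]⇓ z
branch⇓ f-total (p , s) f⇓ =
  dispatch⇓ (λ p → dispatch-total 8 λ s → f-total (p , s)) p
    (dispatch⇓ (λ s → f-total (p , s)) s f⇓)

enter : Control × Word k → Rec k 1
enter ((p , s) , x) = prepend (unary p (unary s x)) (proj zero)

unary-++ : ∀ {m} (i : Fin m) (w x : Word k) → unary i w ++ x ≡ unary i (w ++ x)
unary-++ zero w x = refl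
unary-++ (suc i) w x = cong (𝟎 ∷_) (unary-++ i w x)

enter⇓ : ∀ c (x v : Word k) → enter (c , x) [ v ∷ [] ]⇓ encode (c , x ++ v)
enter⇓ (p , s) x v = subst (enter ((p , s) , x) [ v ∷ [] ]⇓_)
  (trans (unary-++ p (unary s x) v) (cong (unary p) (unary-++ s x v)))
  (prepend⇓ (unary p (unary s x)) proj⇓)

-- `prec` carries the encoded configuration as its value on the tail, `proj (suc zero)`. Once letter
-- and control are known, a step only prepends a constant word, so branching over the finitely many
-- controls suffices.
runner : Rec k 1
runner = prec (prepend (encode ((first , fresh) , [])) ε) λ l →
  comp (branch (λ c → enter (δ l c))) (proj (suc zero) ∷ [])

runner⇓ : ∀ (z : Word k) → runner [ z ∷ [] ]⇓ encode (run z)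
runner⇓ [] = prec-[]⇓ (prepend⇓ (encode ((first , fresh) , [])) ε⇓)
runner⇓ (l ∷ z) = prec-∷⇓ (runner⇓ z) (comp⇓ (proj⇓ ∷ [])
  (branch⇓ (λ c w → _ , enter⇓ (proj₁ (δ l c)) (proj₂ (δ l c)) w) (proj₁ (run z))
    (enter⇓ (proj₁ (δ l (proj₁ (run z)))) _ (proj₂ (run z)))))

-- In the accepting control the collected word is the right component, so `χ` answers for it; any
-- other control means that `z` is no pair.
pairs-computable : {D : Pred (Word k) ℓ} → Computable D →
                   Computable (λ z → ∃₂ λ u v → D v × z ≡ ⟨ u , v ⟩)
pairs-computable {k = k} {D = D} (χ , decide) =
  comp (branch accept) (runner ∷ []) , decide-pair
  where
  _≟_ : (c d : Control) → Dec (c ≡ d)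
  _≟_ = Productₚ.≡-dec Finₚ._≟_ Finₚ._≟_
  accept : Control → Rec k 1
  accept c = if does (c ≟ (second , final)) then χ else prepend (𝟎 ∷ []) ε
  accept-total : ∀ c → Total (accept c)
  accept-total c w with c ≟ (second , final) | decide w
  ... | yes _ | inj₁ (_ , χ⇓) = _ , χ⇓
  ... | yes _ | inj₂ (_ , χ⇓) = _ , χ⇓
  ... | no  _ | _             = _ , prepend⇓ (𝟎 ∷ []) ε⇓
  reject⇓ : ∀ {c v} → c ≢ (second , final) → accept c [ v ∷ [] ]⇓ 𝟎 ∷ []
  reject⇓ {c} c≢ with c ≟ (second , final)
  ... | yes c≡ = ⊥-elim (c≢ c≡)
  ... | no  _  = prepend⇓ (𝟎 ∷ []) ε⇓
  run⇓ : ∀ z {c v y} → run z ≡ (c , v) → accept c [ v ∷ [] ]⇓ y →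
         comp (branch accept) (runner ∷ []) [ z ∷ [] ]⇓ y
  run⇓ z e accept⇓ = comp⇓ (runner⇓ z ∷ [])
    (subst (λ q → branch accept [ encode q ∷ [] ]⇓ _) (sym e) (branch⇓ accept-total _ accept⇓))
  decide-pair : ∀ z → _ ⊎ _
  decide-pair z with run z in e
  ... | c , v with c ≟ (second , final)
  ... | no c≢ = inj₂
    ( (λ { (u , w , _ , refl) → c≢ (cong proj₁ (trans (sym e) (run-⟨,⟩ u w))) })
    , run⇓ z e (reject⇓ c≢))
  ... | yes refl with decide v | run-final z e
  ...   | inj₁ (v∈D , χ⇓) | u , z≡ = inj₁ ((u , v , v∈D , z≡) , run⇓ z e χ⇓)
  -- Any other decomposition of `z` has the same right component, because `run z` computes it.
  ...   | inj₂ (v∉D , χ⇓) | _      = inj₂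
    ( (λ { (u , w , w∈D , refl) →
           v∉D (subst D (cong proj₂ (trans (sym (run-⟨,⟩ u w)) e)) w∈D) })
    , run⇓ z e χ⇓)

-- Rational balls

module _ where
  open ℚₚ.≤-Reasoning
  open +-*-Solver

  square-abs : ∀ p → p ℚ.* p ≡ ∣ p ∣ ℚ.* ∣ p ∣
  square-abs p with ℚₚ.∣p∣≡p∨∣p∣≡-p p
  ... | inj₁ e rewrite e = refl
  ... | inj₂ e rewrite e = solve 1 (λ p → p :* p := (:- p) :* (:- p)) refl p

  square-mono-≤ : ∀ {p q} → 0ℚ ℚ.≤ p → p ℚ.≤ q → p ℚ.* p ℚ.≤ q ℚ.* q
  square-mono-≤ {p} {q} 0≤p p≤q = begin
    p ℚ.* p ≤⟨ ℚₚ.*-monoˡ-≤-nonNeg p {{ℚ.nonNegative 0≤p}} p≤q ⟩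
    p ℚ.* q ≤⟨ ℚₚ.*-monoʳ-≤-nonNeg q {{ℚ.nonNegative (ℚₚ.≤-trans 0≤p p≤q)}} p≤q ⟩
    q ℚ.* q ∎

  square-nonNeg : ∀ p → 0ℚ ℚ.≤ p ℚ.* p
  square-nonNeg p = subst (0ℚ ℚ.≤_) (sym (square-abs p))
    (square-mono-≤ ℚₚ.≤-refl (ℚₚ.0≤∣p∣ p))

  square-pos : ∀ {p} → 0ℚ ℚ.< p → 0ℚ ℚ.< p ℚ.* p
  square-pos {p} 0<p = subst (ℚ._< p ℚ.* p) (ℚₚ.*-zeroʳ p) (ℚₚ.*-monoʳ-<-pos p {{ℚ.positive 0<p}} 0<p)

  abs-<-of-square-< : ∀ {p q} → 0ℚ ℚ.≤ q → p ℚ.* p ℚ.< q ℚ.* q → ∣ p ∣ ℚ.< q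
  abs-<-of-square-< {p} {q} 0≤q p²<q² with ∣ p ∣ ℚ.<? q
  ... | yes p<q = p<q
  ... | no p≮q = contradiction
    (ℚₚ.<-≤-trans p²<q² (subst (q ℚ.* q ℚ.≤_) (sym (square-abs p))
      (square-mono-≤ 0≤q (ℚₚ.≮⇒≥ p≮q))))
    (ℚₚ.<-irrefl refl)

  -- Avoids square roots: closeness within both 1 and e already makes the square at most e.
  square-≤ : ∀ {p e} → ∣ p ∣ ℚ.≤ 1ℚ → ∣ p ∣ ℚ.≤ e → p ℚ.* p ℚ.≤ e
  square-≤ {p} {e} p≤1 p≤e = begin
    p ℚ.* p          ≡⟨ square-abs p ⟩
    ∣ p ∣ ℚ.* ∣ p ∣  ≤⟨ ℚₚ.*-monoˡ-≤-nonNeg ∣ p ∣ {{ℚₚ.∣-∣-nonNeg p}} p≤1 ⟩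
    ∣ p ∣ ℚ.* 1ℚ     ≡⟨ ℚₚ.*-identityʳ ∣ p ∣ ⟩
    ∣ p ∣            ≤⟨ p≤e ⟩
    e                ∎

  double : ℚ → ℚ
  double p = p ℚ.+ p

  double-mono-≤ : ∀ {p q} → p ℚ.≤ q → double p ℚ.≤ double q
  double-mono-≤ p≤q = ℚₚ.+-mono-≤ p≤q p≤q

  -- The parallelogram identity for p - r and q - r, with the square of their sum left out.
  square-triangle : ∀ p q r → (p ℚ.- q) ℚ.* (p ℚ.- q) ℚ.≤
                    double ((p ℚ.- r) ℚ.* (p ℚ.- r) ℚ.+ (q ℚ.- r) ℚ.* (q ℚ.- r))
  square-triangle p q r = begin
    d ℚ.* d                    ≡⟨ ℚₚ.+-identityʳ (d ℚ.* d) ⟨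
    d ℚ.* d ℚ.+ 0ℚ             ≤⟨ ℚₚ.+-monoʳ-≤ (d ℚ.* d) (square-nonNeg s) ⟩
    d ℚ.* d ℚ.+ s ℚ.* s        ≡⟨ solve 3 (λ p q r →
                                    (p :- q) :* (p :- q) :+ ((p :- r) :+ (q :- r)) :* ((p :- r) :+ (q :- r)) :=
                                    ((p :- r) :* (p :- r) :+ (q :- r) :* (q :- r)) :+
                                    ((p :- r) :* (p :- r) :+ (q :- r) :* (q :- r))) refl p q r ⟩
    double ((p ℚ.- r) ℚ.* (p ℚ.- r) ℚ.+ (q ℚ.- r) ℚ.* (q ℚ.- r)) ∎
    where
    d s : ℚ
    d = p ℚ.- q
    s = (p ℚ.- r) ℚ.+ (q ℚ.- r)

  dist²-nonNeg : ∀ {n} (x y : Vector ℝ n) m → 0ℚ ℚ.≤ seq (dist² x y) m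
  dist²-nonNeg {zero} x y m = ℚₚ.≤-refl
  dist²-nonNeg {suc n} x y m =
    ℚₚ.+-mono-≤ (square-nonNeg (seq (x zero) m ℚ.- seq (y zero) m))
      (dist²-nonNeg (x ∘ suc) (y ∘ suc) m)

  component-≤-dist² : ∀ {n} (x y : Vector ℝ n) m i →
    (seq (x i) m ℚ.- seq (y i) m) ℚ.* (seq (x i) m ℚ.- seq (y i) m) ℚ.≤ seq (dist² x y) m
  component-≤-dist² {suc n} x y m zero = begin
    d ℚ.* d                                      ≡⟨ ℚₚ.+-identityʳ (d ℚ.* d) ⟨
    d ℚ.* d ℚ.+ 0ℚ                               ≤⟨ ℚₚ.+-monoʳ-≤ (d ℚ.* d) (dist²-nonNeg (x ∘ suc) (y ∘ suc) m) ⟩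
    d ℚ.* d ℚ.+ seq (dist² (x ∘ suc) (y ∘ suc)) m ∎
    where
    d : ℚ
    d = seq (x zero) m ℚ.- seq (y zero) m
  component-≤-dist² {suc n} x y m (suc i) = begin
    e ℚ.* e                ≤⟨ component-≤-dist² (x ∘ suc) (y ∘ suc) m i ⟩
    rest                   ≡⟨ ℚₚ.+-identityˡ rest ⟨
    0ℚ ℚ.+ rest            ≤⟨ ℚₚ.+-monoˡ-≤ rest (square-nonNeg d) ⟩
    d ℚ.* d ℚ.+ rest       ∎
    where
    d e rest : ℚ
    d = seq (x zero) m ℚ.- seq (y zero) m
    e = seq (x (suc i)) m ℚ.- seq (y (suc i)) m
    rest = seq (dist² (x ∘ suc) (y ∘ suc)) m

  dist²-triangle : ∀ {n} (x y z : Vector ℝ n) m →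
    seq (dist² x y) m ℚ.≤ double (seq (dist² x z) m ℚ.+ seq (dist² y z) m)
  dist²-triangle {zero} x y z m = ℚₚ.≤-refl
  dist²-triangle {suc n} x y z m = begin
    _ ≤⟨ ℚₚ.+-mono-≤ (square-triangle (seq (x zero) m) (seq (y zero) m) (seq (z zero) m))
           (dist²-triangle (x ∘ suc) (y ∘ suc) (z ∘ suc) m) ⟩
    double (p ℚ.+ q) ℚ.+ double (r ℚ.+ s)
      ≡⟨ solve 4 (λ p q r s → ((p :+ q) :+ (p :+ q)) :+ ((r :+ s) :+ (r :+ s)) :=
           ((p :+ r) :+ (q :+ s)) :+ ((p :+ r) :+ (q :+ s))) refl p q r s ⟩
    double ((p ℚ.+ r) ℚ.+ (q ℚ.+ s)) ∎
    where
    p q r s : ℚ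
    p = (seq (x zero) m ℚ.- seq (z zero) m) ℚ.* (seq (x zero) m ℚ.- seq (z zero) m)
    q = (seq (y zero) m ℚ.- seq (z zero) m) ℚ.* (seq (y zero) m ℚ.- seq (z zero) m)
    r = seq (dist² (x ∘ suc) (z ∘ suc)) m
    s = seq (dist² (y ∘ suc) (z ∘ suc)) m

  -- Each coordinate of `c` is a late term of the Cauchy sequence of that coordinate of `x`; half of
  -- the error goes to the first coordinate, the rest to the others.
  rational-point-near : ∀ {n} (x : Vector ℝ n) e → 0ℚ ℚ.< e →
    Σ[ c ∈ Vector ℚ n ] ∃ λ N → ∀ m → N ℕ.≤ m → seq (dist² x (fromℚ ∘ c)) m ℚ.≤ e
  rational-point-near {zero} x e 0<e = (λ ()) , 0 , λ _ _ → ℚₚ.<⇒≤ 0<e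
  rational-point-near {suc n} x e 0<e =
    let N₁ , near-1 = close (cauchy (x zero)) 1ℚ (ℚₚ.positive⁻¹ 1ℚ)
        N₂ , near-e = close (cauchy (x zero)) (½ ℚ.* e) (half-pos 0<e)
        c , N₃ , rest = rational-point-near (x ∘ suc) (½ ℚ.* e) (half-pos 0<e)
        N = N₁ ℕ.⊔ N₂
        N₁≤N = ℕₚ.m≤m⊔n N₁ N₂
        N₂≤N = ℕₚ.m≤n⊔m N₁ N₂
    in (λ { zero → seq (x zero) N ; (suc i) → c i }) , N ℕ.⊔ N₃ , λ m K≤m →
    let N≤m = ℕₚ.m⊔n≤o⇒m≤o N N₃ K≤m in begin
    _ ≤⟨ ℚₚ.+-mono-≤
           (square-≤ (ℚₚ.<⇒≤ (near-1 m N (ℕₚ.≤-trans N₁≤N N≤m) N₁≤N))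
                     (ℚₚ.<⇒≤ (near-e m N (ℕₚ.≤-trans N₂≤N N≤m) N₂≤N)))
           (rest m (ℕₚ.m⊔n≤o⇒n≤o N N₃ K≤m)) ⟩
    ½ ℚ.* e ℚ.+ ½ ℚ.* e ≡⟨ halves e ⟩
    e ∎

  -- The gap is kept, since p² is eventually at most the square of each term of `r`.
  Ball-mono : ∀ {n} {x : Vector ℝ n} {p r N} → 0ℚ ℚ.≤ p → (∀ m → N ℕ.≤ m → p ℚ.≤ seq r m) →
              Ball x (fromℚ p) ⊆ Ball x r
  Ball-mono {N = N} 0≤p p≤r (mk< e 0<e M h) = mk< e 0<e (N ℕ.⊔ M) λ m K≤m →
    ℚₚ.≤-trans (h m (ℕₚ.m⊔n≤o⇒n≤o N M K≤m)) (square-mono-≤ 0≤p (p≤r m (ℕₚ.m⊔n≤o⇒m≤o N M K≤m)))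

  -- For ∥ x - c ∥² ≤ r² / 8 and ∥ y - c ∥² < r² / 4, the bound
  -- ∥ y - x ∥² ≤ 2 (∥ y - c ∥² + ∥ x - c ∥²) replaces the triangle inequality.
  rational-ball-near : ∀ {n} (x : Vector ℝ n) r → 0ℚ ℚ.< r →
    Σ[ c ∈ Vector ℚ n ] ∃ λ s → 0ℚ ℚ.< s ×
      x ∈ Ball (fromℚ ∘ c) (fromℚ s) × Ball (fromℚ ∘ c) (fromℚ s) ⊆ Ball x (fromℚ r)
  rational-ball-near x r 0<r =
    let c , N , near = rational-point-near x e 0<e
    in c , s , half-pos 0<r ,
    -- As half of s², `e` both bounds the squared distance from `x` to `c` and is the gap that
    -- remains.
    mk< e 0<e N (λ m N≤m → begin
      _                ≤⟨ ℚₚ.+-monoˡ-≤ e (near m N≤m) ⟩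
      e ℚ.+ e          ≡⟨ halves (s ℚ.* s) ⟩
      s ℚ.* s          ∎) ,
    λ {y} (mk< g 0<g M h) → mk< g 0<g (N ℕ.⊔ M) λ m K≤m →
      let a = seq (dist² y (fromℚ ∘ c)) m
          b = seq (dist² x (fromℚ ∘ c)) m
      in begin
      _                                    ≤⟨ ℚₚ.+-monoˡ-≤ g (dist²-triangle y x (fromℚ ∘ c) m) ⟩
      double (a ℚ.+ b) ℚ.+ g               ≡⟨ ℚₚ.+-identityʳ _ ⟨
      -- A second `g` is added so that each of the two copies of `a` gets its own gap.
      double (a ℚ.+ b) ℚ.+ g ℚ.+ 0ℚ        ≤⟨ ℚₚ.+-monoʳ-≤ (double (a ℚ.+ b) ℚ.+ g) (ℚₚ.<⇒≤ 0<g) ⟩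
      double (a ℚ.+ b) ℚ.+ g ℚ.+ g         ≡⟨ solve 3 (λ a b g → ((a :+ b) :+ (a :+ b)) :+ g :+ g :=
                                                ((a :+ g) :+ b) :+ ((a :+ g) :+ b)) refl a b g ⟩
      double ((a ℚ.+ g) ℚ.+ b)             ≤⟨ double-mono-≤ (ℚₚ.+-mono-≤
                                                (h m (ℕₚ.m⊔n≤o⇒n≤o N M K≤m))
                                                (ℚₚ.≤-trans (near m (ℕₚ.m⊔n≤o⇒m≤o N M K≤m)) e≤s²)) ⟩
      double (s ℚ.* s ℚ.+ s ℚ.* s)         ≡⟨ solve 1 (λ r → let s² = (con ½ :* r) :* (con ½ :* r) in
                                                (s² :+ s²) :+ (s² :+ s²) := r :* r) refl r ⟩
      r ℚ.* r                              ∎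
    where
    s e : ℚ
    s = ½ ℚ.* r
    e = ½ ℚ.* (s ℚ.* s)
    0<e : 0ℚ ℚ.< e
    0<e = half-pos (square-pos (half-pos 0<r))
    e≤s² : e ℚ.≤ s ℚ.* s
    e≤s² = begin
      e          ≡⟨ ℚₚ.+-identityʳ e ⟨
      e ℚ.+ 0ℚ   ≤⟨ ℚₚ.+-monoʳ-≤ e (ℚₚ.<⇒≤ 0<e) ⟩
      e ℚ.+ e    ≡⟨ halves (s ℚ.* s) ⟩
      s ℚ.* s    ∎

  -- At a common index m each coordinate difference is bounded by the distance, hence below e / 2;
  -- the Cauchy property of `x i` then moves one index from m to n.
  in-all-balls⇒≈ : ∀ {n} (x y : Vector ℝ n) →
    (∀ r → 0ℚ ℚ.< r → y ∈ Ball x (fromℚ r)) → Setoid._≈_ (ℝ^ n) y x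
  in-all-balls⇒≈ x y near i = mk≈ (mkClose λ e 0<e →
    let mk< g 0<g N h = near (½ ℚ.* e) (half-pos 0<e)
        M , x-cauchy = close (cauchy (x i)) (½ ℚ.* e) (half-pos 0<e)
    in N ℕ.⊔ M , λ m n K≤m K≤n →
    let a = seq (y i) m
        b = seq (x i) m
        c = seq (x i) n
        d = seq (dist² y x) m
    in begin-strict
      ∣ a ℚ.- c ∣
        ≡⟨ cong ∣_∣ (solve 3 (λ a b c → a :- c := (a :- b) :+ (b :- c)) refl a b c) ⟩
      ∣ (a ℚ.- b) ℚ.+ (b ℚ.- c) ∣
        ≤⟨ ℚₚ.∣p+q∣≤∣p∣+∣q∣ (a ℚ.- b) (b ℚ.- c) ⟩
      ∣ a ℚ.- b ∣ ℚ.+ ∣ b ℚ.- c ∣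
        <⟨ ℚₚ.+-mono-<
             (abs-<-of-square-< {a ℚ.- b} (ℚₚ.<⇒≤ (half-pos 0<e)) (begin-strict
               (a ℚ.- b) ℚ.* (a ℚ.- b)  ≤⟨ component-≤-dist² y x m i ⟩
               d                        ≡⟨ ℚₚ.+-identityʳ d ⟨
               d ℚ.+ 0ℚ                 <⟨ ℚₚ.+-monoʳ-< d 0<g ⟩
               d ℚ.+ g                  ≤⟨ h m (ℕₚ.m⊔n≤o⇒m≤o N M K≤m) ⟩
               (½ ℚ.* e) ℚ.* (½ ℚ.* e)  ∎))
             (x-cauchy m n (ℕₚ.m⊔n≤o⇒n≤o N M K≤m) (ℕₚ.m⊔n≤o⇒n≤o N M K≤n)) ⟩
      ½ ℚ.* e ℚ.+ ½ ℚ.* e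
        ≡⟨ halves e ⟩
      e ∎)

⊓-pos : ∀ {p q} → 0ℚ ℚ.< p → 0ℚ ℚ.< q → 0ℚ ℚ.< p ℚ.⊓ q
⊓-pos {p} {q} 0<p 0<q with ℚₚ.⊓-sel p q
... | inj₁ e = subst (0ℚ ℚ.<_) (sym e) 0<p
... | inj₂ e = subst (0ℚ ℚ.<_) (sym e) 0<q

-- The balls of an atlas

module _ {ℓ : Level} {k n : ℕ} (μ : PartialMap k ⟦ RationalBalls n ⟧) (μ-notation : IsNotation μ)
         {X : Setoid ℓ ℓ} (Φ : Atlas k n X) where
  private
    module Φ = Atlas Φ
    open Setoid X using (_≈_)

  ball-neighbourhood : ∀ i (p : Φ.I i) {x} (x∈U : x ∈ Φ.U i p) r → 0ℚ ℚ.< r →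
    ∃₂ λ w q → x ∈ B μ Φ i w q × ball μ Φ w q ⊆ Ball (Injection.to (Φ.φ i p) (x , x∈U)) (fromℚ r)
  ball-neighbourhood i p {x} x∈U r 0<r =
    let φx = Injection.to (Φ.φ i p) (x , x∈U)
        R , mk< g 0<g N g≤R , Ball⊆image =
          Chart.open-image (Φ.chart i p) {φx} ((x , x∈U) , x∈U , Setoid.refl (ℝ^ n) {φx})
        -- The gap `g` in 0 < R is a rational that the terms of `R` eventually reach, so a ball of
        -- radius `t` lies both in the image of the chart and in the ball of radius `r`.
        t = g ℚ.⊓ r
        0<t = ⊓-pos 0<g 0<r
        0≤t = ℚₚ.<⇒≤ 0<t
        c , s , 0<s , φx∈ , ⊆Ball = rational-ball-near φx t 0<t
        w , q , b⊆ , ⊆b = μ-notation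
          (Ball (fromℚ ∘ c) (fromℚ s) , c , s , 0<s , (λ v → v) , (λ v → v))
    in w , q ,
       ( p
       , (λ {v} v∈b → Ball⊆image (Ball-mono {x = φx} {r = R} 0≤t
           (λ m N≤m → ℚₚ.≤-trans (ℚₚ.p⊓q≤p g r)
             (subst (ℚ._≤ seq R m) (ℚₚ.+-identityˡ g) (g≤R m N≤m)))
           {v} (⊆Ball {v} (b⊆ {v} v∈b))))
       , x∈U
       , ⊆b {φx} φx∈) ,
       λ {v} v∈b → Ball-mono {x = φx} {r = fromℚ r} {N = 0} 0≤t (λ _ _ → ℚₚ.p⊓q≤q g r)
         {v} (⊆Ball {v} (b⊆ {v} v∈b))

  B∈𝓑 : ∀ i w q → B μ Φ i w q ∈ 𝓑 μ Φ
  B∈𝓑 i w q = i , w , q , (λ v → v) , (λ v → v)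

  𝓑-covers : ∀ x → ∃ λ V → V ∈ 𝓑 μ Φ × x ∈ V
  𝓑-covers x =
    let i , p , x∈U = Φ.covers x
        w , q , x∈B , _ = ball-neighbourhood i p x∈U 1ℚ (ℚₚ.positive⁻¹ 1ℚ)
    in B μ Φ i w q , B∈𝓑 i w q , x∈B

  𝓑-separates : ∀ x y → 𝓟 X (𝓑 μ Φ) x ⊆ 𝓟 X (𝓑 μ Φ) y → x ≈ y
  𝓑-separates x y 𝓟x⊆𝓟y =
    let i , p , x∈U = Φ.covers x
        φ = Injection.to (Φ.φ i p)
        near : ∀ r → 0ℚ ℚ.< r → ∃ λ y∈U → φ (y , y∈U) ∈ Ball (φ (x , x∈U)) (fromℚ r)
        near r 0<r =
          let w , q , x∈B , b⊆ = ball-neighbourhood i p x∈U r 0<r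
              p′ , _ , y∈U , φy∈b = proj₂ (𝓟x⊆𝓟y {B μ Φ i w q} (B∈𝓑 i w q , x∈B))
          -- Membership of `y` in the ball gives back the index `i`, but with its own proof of i ∈
          -- I; irrelevance makes the chart the same.
          in subst (λ p′ → (y∈U : y ∈ Φ.U i p′) → Injection.to (Φ.φ i p′) (y , y∈U) ∈ ball μ Φ w q →
                      ∃ λ y∈U → φ (y , y∈U) ∈ Ball (φ (x , x∈U)) (fromℚ r))
               (Φ.I-irrelevant p p′)
               (λ y∈U φy∈b → y∈U , b⊆ {φ (y , y∈U)} φy∈b) y∈U φy∈b
        -- One membership proof is fixed here; those obtained for other radii give an equal chart
        -- value, by congruence of the chart map.
        y∈U , _ = near 1ℚ (ℚₚ.positive⁻¹ 1ℚ)
    in Setoid.sym X (Injection.injective (Φ.φ i p) {y , y∈U} {x , x∈U}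
         (in-all-balls⇒≈ (φ (x , x∈U)) (φ (y , y∈U)) λ r 0<r →
           let y∈U′ , φy∈Ball = near r 0<r in
           resp (Ball (φ (x , x∈U)) (fromℚ r)) {φ (y , y∈U′)} {φ (y , y∈U)}
             (Injection.cong (Φ.φ i p) (Setoid.refl X)) φy∈Ball))

lemma3p2 : {ℓ : Level} (k n : ℕ) (μ : PartialMap k ⟦ RationalBalls n ⟧) →
    IsNotation μ → Computable (dom μ) →
    (X : Setoid ℓ ℓ) → Setoid.Carrier X → (Φ : Atlas k n X) →
    IsComputablePredicateSpace X (𝓑 μ Φ) (λΦ μ Φ)
lemma3p2 k n μ μ-notation dom-μ X _ Φ = record
  { isEffectivePredicateSpace = record
    -- A computable domain is in particular decidable, so the balls are enumerated along their
    -- names.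
    { countable = notation⇒countable (λΦ μ Φ) notation (computable⇒decidable dom-λΦ)
    ; covers    = 𝓑-covers μ μ-notation Φ
    ; notation  = notation
    ; separated = λ x y → mk⇔
        (λ x≈y → (λ {V} (V∈𝓑 , x∈V) → V∈𝓑 , resp V x≈y x∈V) ,
                 (λ {V} (V∈𝓑 , y∈V) → V∈𝓑 , resp V (Setoid.sym X x≈y) y∈V))
        (λ (𝓟x⊆𝓟y , _) → 𝓑-separates μ μ-notation Φ x y (λ {V} → 𝓟x⊆𝓟y {V}))
    }
  ; dom-computable = dom-λΦ
  }
  where
  dom-λΦ : Computable (dom (λΦ μ Φ))
  dom-λΦ = pairs-computable dom-μ
  notation : IsNotation (λΦ μ Φ)
  notation (V , i , w , p , V⊆B , B⊆V) =
    ⟨ i , w ⟩ , (i , w , p , refl) , (λ {x} → B⊆V {x}) , (λ {x} → V⊆B {x})
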